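{- Let $k \ge 3$ be an integer and let $G^I(k) = (C \cup (V\setminus C), E)$ be any graph with vertex set $V$ and $C\subseteq V$ such that $|C|=k$, the induced subgraph $G^I(k)[C]$ has no closed twins, and $V\setminus C$ consists of exactly one vertex $v_{C'}$ with $N(v_{C'})\cap C=C'$ for each non-empty subset $C'\subseteq C$ such that there is no vertex $u\in C$ with $N[u]\cap C=C'$ (with no condition on the edges inside $V\setminus C$). Then in $G^I(k)$, the set $C$ is a minimum-cardinality (i) ID-code; (ii) ITD-code if $G^I(k)[C]$ has no isolated vertex, that is, if $G^I(k)[C]$ is ITD-admissible. Moreover, for $X \in \{\mathrm{ID}, \mathrm{ITD}\}$, the minimum X-density among all X-admissible graphs with X-number $k$ is attained by any graph $G^I(k)$ if $X=\mathrm{ID}$, and by those graphs $G^I(k)$ for which $G^I(k)[C]$ has no isolated vertex if $X=\mathrm{ITD}$.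
   Context: Graphs are finite, simple and undirected. For a graph $G=(V,E)$ and $v\in V$, $N(v)$ is the open neighborhood and $N[v]=N(v)\cup\{v\}$ the closed neighborhood; $G[C]$ is the subgraph induced by $C$. Closed twins are distinct adjacent vertices $u,v$ with $N[u]=N[v]$. A set $C\subseteq V$ is dominating (resp. total-dominating) if $N[v]\cap C\neq\emptyset$ (resp. $N(v)\cap C\ne\emptyset$) for all $v\in V$. A set $C$ is closed-separating if $N[u]\cap C\neq N[v]\cap C$ for all distinct $u,v\in V$. An ID-code (resp. ITD-code) is a set that is closed-separating and dominating (resp. total-dominating). A graph is X-admissible if it has an X-code; the X-number $\gamma^{X}(G)$ of an X-admissible graph is the minimum cardinality of an X-code of $G$. The X-density of an X-admissible graph $G$ on $n$ vertices is $\gamma^{X}(G)/n$. -}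

module Defs where

open import Data.Fin using (Fin; zero; suc)
open import Data.Fin.Properties using (suc-injective)
open import Data.Fin.Subset using (Subset; inside; outside; _∈_; _∉_; _⊆_; _∩_; _∪_; ⁅_⁆; ∣_∣; Nonempty; Empty)
open import Data.Integer using (+_)
open import Data.Nat using (ℕ; NonZero) renaming (_≤_ to _≤ⁿ_)
open import Data.Product using (∃; ∃!; ∃-syntax; _×_; _,_)
open import Data.Rational using (ℚ; _/_; _≤_)
open import Data.Vec using ([]; _∷_; tabulate; here; there)
open import Function.Base using (_on_)
open import Level using (0ℓ)
open import Relation.Binary.Core using (Rel)
open import Relation.Binary.Definitions using (Decidable; Irreflexive; Symmetric)
open import Relation.Binary.PropositionalEquality using (_≡_; _≢_; refl; cong)
open import Relation.Nullary using (¬_; does)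

private
  variable
    n : ℕ

record Graph (n : ℕ) : Set₁ where
  infix 4 _~_ _~?_
  field
    _~_    : Rel (Fin n) 0ℓ
    _~?_   : Decidable _~_
    sym    : Symmetric _~_
    irrefl : Irreflexive _≡_ _~_

  N : Fin n → Subset n
  N v = tabulate (λ u → does (v ~? u))

  N[_] : Fin n → Subset n
  N[ v ] = N v ∪ ⁅ v ⁆

open Graph using (N; N[_])

-- The elements of C in increasing order; by the three lemmas below this is
-- a bijection from Fin ∣ C ∣ onto C.
element : (C : Subset n) → Fin ∣ C ∣ → Fin n
element (inside  ∷ C) zero    = zero
element (inside  ∷ C) (suc i) = suc (element C i)
element (outside ∷ C) i       = suc (element C i)

element-∈ : (C : Subset n) (i : Fin ∣ C ∣) → element C i ∈ C
element-∈ (inside  ∷ C) zero    = here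
element-∈ (inside  ∷ C) (suc i) = there (element-∈ C i)
element-∈ (outside ∷ C) i       = there (element-∈ C i)

element-injective : (C : Subset n) {i j : Fin ∣ C ∣} → element C i ≡ element C j → i ≡ j
element-injective (inside  ∷ C) {zero}  {zero}  _  = refl
element-injective (inside  ∷ C) {suc i} {suc j} eq = cong suc (element-injective C (suc-injective eq))
element-injective (outside ∷ C) eq                 = element-injective C (suc-injective eq)

element-surjective : (C : Subset n) {v : Fin n} → v ∈ C → ∃[ i ] element C i ≡ v
element-surjective (inside  ∷ C) here = zero , refl
element-surjective (inside  ∷ C) (there v∈C) with element-surjective C v∈C
... | i , refl = suc i , refl
element-surjective (outside ∷ C) (there v∈C) with element-surjective C v∈C
... | i , refl = i , refl

-- The induced subgraph on C, with vertices relabelled along `element`.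
infix 8 _[_]
_[_] : Graph n → (C : Subset n) → Graph ∣ C ∣
G [ C ] = record
  { _~_    = _~_ on element C
  ; _~?_   = λ i j → element C i ~? element C j
  ; sym    = sym
  ; irrefl = λ i≡j → irrefl (cong (element C) i≡j)
  }
  where open Graph G

ClosedTwins : Graph n → Fin n → Fin n → Set
ClosedTwins G u v = u ≢ v × u ~ v × N[ G ] u ≡ N[ G ] v
  where open Graph G using (_~_)

NoClosedTwins : Graph n → Set
NoClosedTwins G = ∀ u v → ¬ ClosedTwins G u v

Isolated : Graph n → Fin n → Set
Isolated G v = Empty (N G v)

NoIsolatedVertex : Graph n → Set
NoIsolatedVertex G = ∀ v → ¬ Isolated G v

Dominating : Graph n → Subset n → Set
Dominating G C = ∀ v → Nonempty (N[ G ] v ∩ C)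

TotalDominating : Graph n → Subset n → Set
TotalDominating G C = ∀ v → Nonempty (N G v ∩ C)

ClosedSeparating : Graph n → Subset n → Set
ClosedSeparating G C = ∀ u v → u ≢ v → N[ G ] u ∩ C ≢ N[ G ] v ∩ C

data CodeType : Set where
  ID ITD : CodeType

IsCode : CodeType → Graph n → Subset n → Set
IsCode ID  G C = ClosedSeparating G C × Dominating G C
IsCode ITD G C = ClosedSeparating G C × TotalDominating G C

Admissible : CodeType → Graph n → Set
Admissible X G = ∃[ C ] IsCode X G C

IsMinimumCode : CodeType → Graph n → Subset n → Set
IsMinimumCode X G C = IsCode X G C × (∀ D → IsCode X G D → ∣ C ∣ ≤ⁿ ∣ D ∣)

-- G is X-admissible and its X-number is γ.
HasNumber : CodeType → Graph n → ℕ → Set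
HasNumber X G γ = ∃[ C ] IsMinimumCode X G C × ∣ C ∣ ≡ γ

-- G is X-admissible and its X-density is q; the graph without vertices has
-- no density.
record HasDensity (X : CodeType) (G : Graph n) (q : ℚ) : Set where
  field
    γ           : ℕ
    hasNumber   : HasNumber X G γ
    {{nonZero}} : NonZero n
    density     : q ≡ + γ / n

-- The X-density of G is the minimum X-density among all X-admissible graphs
-- with X-number k (G itself being one of them).
AttainsMinimumDensity : CodeType → ℕ → Graph n → Set₁
AttainsMinimumDensity X k G =
  HasNumber X G k ×
  ∃[ q ] HasDensity X G q ×
    (∀ {m} (H : Graph m) r → HasNumber X H k → HasDensity X H r → q ≤ r)

-- The nonempty subsets C′ of C that are not of the form N[u] ∩ C with u ∈ C.
Missing : Graph n → Subset n → Subset n → Set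
Missing G C C′ = Nonempty C′ × C′ ⊆ C × ¬ (∃[ u ] u ∈ C × N[ G ] u ∩ C ≡ C′)

-- G = (C ∪ (V ∖ C), E) is one of the graphs G^I(k); edges inside V ∖ C are
-- unconstrained.
record IsGᴵ (k : ℕ) (G : Graph n) (C : Subset n) : Set where
  field
    size    : ∣ C ∣ ≡ k
    no-twin : NoClosedTwins (G [ C ])
    -- V ∖ C has exactly one vertex for each missing C′, and no other vertex.
    unique  : ∀ C′ → Missing G C C′ → ∃! _≡_ (λ v → v ∉ C × N G v ∩ C ≡ C′)
    only    : ∀ v → v ∉ C → ∃[ C′ ] Missing G C C′ × N G v ∩ C ≡ C′

{-# OPTIONS --safe #-}
-- A dominating and closed-separating set D gives the vertices distinct nonempty
-- traces N[v] ∩ D, so a graph on m vertices satisfies m + 1 ≤ 2 ^ ∣ D ∣. In G^I(k)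
-- the traces on C exhaust the nonempty subsets of C, so n + 1 = 2 ^ k: codes have
-- at least k vertices, and no graph with X-number k has more than n vertices.
-- A total-dominating set is dominating, so the same bound serves ITD-codes.
module Submission where

open import Defs
open import Data.Bool.Properties using () renaming (_≟_ to _≟ᵇ_)
open import Data.Fin using (Fin; zero; suc)
open import Data.Fin.Properties
  using (_≟_; any?; injective⇒≤; *↔×; 2↔Bool)
open import Data.Fin.Subset
open import Data.Fin.Subset.Properties
import Data.Integer as ℤ
import Data.Integer.Properties as ℤ
open import Data.Nat using (ℕ; zero; suc; _^_; _≤_; _<_; NonZero; >-nonZero; s≤s; z≤n; s≤s⁻¹)
open import Data.Nat.Properties
  using (≤-trans; ≤-antisym; ≮⇒≥; <⇒≱; ^-monoʳ-<)
open import Data.Product using (∃-syntax; _×_; _,_; proj₁; proj₂)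
open import Data.Product.Function.NonDependent.Propositional using (_×-↔_)
import Data.Rational as ℚ
import Data.Rational.Properties as ℚ
import Data.Rational.Unnormalised as ℚᵘ
import Data.Rational.Unnormalised.Properties as ℚᵘ
open import Data.Sum using (_⊎_; inj₁; inj₂)
open import Data.Vec using ([]; _∷_; lookup; tabulate; here; there)
open import Data.Vec.Properties using (≡-dec; []=⇒lookup; lookup⇒[]=; lookup∘tabulate)
open import Function.Base using (_∘_)
open import Function.Bundles using (_⇔_; _↔_; mk⇔; mk↔ₛ′; Injection; Inverse)
open import Function.Construct.Composition using (_↔-∘_)
open import Function.Construct.Symmetry using (↔-sym)
open import Function.Properties.Inverse using (↔⇒↣)
open import Function.Definitions using (Injective; StrictlySurjective)
open import Relation.Binary.PropositionalEquality
  using (_≡_; _≢_; refl; sym; trans; cong; subst; module ≡-Reasoning)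
open import Relation.Nullary using (yes; no; contradiction; _×-dec_)
open import Relation.Nullary.Decidable using (dec-true)

open Graph using (N; N[_])

private
  variable
    n : ℕ

-- Counting subsets.

Subset↔Fin : ∀ n → Subset n ↔ Fin (2 ^ n)
Subset↔Fin zero    = mk↔ₛ′ (λ _ → zero) (λ _ → []) (λ { zero → refl }) (λ { [] → refl })
Subset↔Fin (suc n) = ↔-sym *↔× ↔-∘ ((↔-sym 2↔Bool ×-↔ Subset↔Fin n) ↔-∘
  mk↔ₛ′ (λ { (b ∷ p) → b , p }) (λ { (b , p) → b ∷ p }) (λ { (_ , _) → refl }) (λ { (_ ∷ _) → refl }))

module _ {m n} {f : Fin m → Subset n} where

  injective⇒≤2^ : Injective _≡_ _≡_ f → m ≤ 2 ^ n
  injective⇒≤2^ f-inj = injective⇒≤ (f-inj ∘ Injection.injective (↔⇒↣ (Subset↔Fin n)))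

  -- Choosing a preimage of every subset gives a section of `f`, and a section is injective.
  surjective⇒2^≤ : StrictlySurjective _≡_ f → 2 ^ n ≤ m
  surjective⇒2^≤ f-surj = injective⇒≤ {f = proj₁ ∘ f-surj ∘ decode} λ {i} {j} eq →
    Injection.injective (↔⇒↣ (↔-sym (Subset↔Fin n)))
      (trans (sym (proj₂ (f-surj (decode i)))) (trans (cong f eq) (proj₂ (f-surj (decode j)))))
    where decode = Inverse.from (Subset↔Fin n)

-- Traces on a vertex set.

-- The trace of A on C, with the elements of C relabelled along `element`.
trace : (C : Subset n) → Subset n → Subset ∣ C ∣
trace C A = tabulate (lookup A ∘ element C)

∈-trace⁺ : ∀ (C : Subset n) {A i} → element C i ∈ A → i ∈ trace C A
∈-trace⁺ C {A} {i} e∈A =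
  lookup⇒[]= i _ (trans (lookup∘tabulate (lookup A ∘ element C) i) ([]=⇒lookup e∈A))

∈-trace⁻ : ∀ (C : Subset n) {A i} → i ∈ trace C A → element C i ∈ A
∈-trace⁻ C {A} {i} i∈t =
  lookup⇒[]= _ A (trans (sym (lookup∘tabulate (lookup A ∘ element C) i)) ([]=⇒lookup i∈t))

trace≡⇒∩⊆∩ : ∀ (C : Subset n) {A B} → trace C A ≡ trace C B → A ∩ C ⊆ B ∩ C
trace≡⇒∩⊆∩ C {A} {B} eq x∈A∩C with x∈p∩q⁻ A C x∈A∩C
... | x∈A , x∈C with element-surjective C x∈C
... | i , refl = x∈p∩q⁺ (∈-trace⁻ C (subst (i ∈_) eq (∈-trace⁺ C x∈A)) , x∈C)

trace≡⇒∩≡∩ : ∀ (C : Subset n) {A B} → trace C A ≡ trace C B → A ∩ C ≡ B ∩ C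
trace≡⇒∩≡∩ C eq = ⊆-antisym (trace≡⇒∩⊆∩ C eq) (trace≡⇒∩⊆∩ C (sym eq))

trace-nonempty : ∀ (C : Subset n) {A} → Nonempty (A ∩ C) → trace C A ≢ ⊥
trace-nonempty C {A} (x , x∈A∩C) eq with x∈p∩q⁻ A C x∈A∩C
... | x∈A , x∈C with element-surjective C x∈C
... | i , refl = ∉⊥ (subst (i ∈_) eq (∈-trace⁺ C x∈A))

trace-∩ : ∀ (C A : Subset n) → trace C (A ∩ C) ≡ trace C A
trace-∩ C A = ⊆-antisym
  (∈-trace⁺ C ∘ p∩q⊆p A C ∘ ∈-trace⁻ C)
  (λ {i} i∈t → ∈-trace⁺ C (x∈p∩q⁺ {p = A} (∈-trace⁻ C i∈t , element-∈ C i)))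

-- A right inverse of `trace C` with values among the subsets of `C`. Surjectivity of `closedTrace`
-- is reduced along it to realising subsets of `C`.
expand : (C : Subset n) → Subset ∣ C ∣ → Subset n
expand []            []      = []
expand (inside  ∷ C) (b ∷ S) = b ∷ expand C S
expand (outside ∷ C) S       = outside ∷ expand C S

expand⊆ : ∀ (C : Subset n) S → expand C S ⊆ C
expand⊆ (inside  ∷ C) (_ ∷ S) here      = here
expand⊆ (inside  ∷ C) (_ ∷ S) (there x) = there (expand⊆ C S x)
expand⊆ (outside ∷ C) S       (there x) = there (expand⊆ C S x)

∈-expand⁺ : ∀ (C : Subset n) {S i} → i ∈ S → element C i ∈ expand C S
∈-expand⁺ (inside  ∷ C) here      = here
∈-expand⁺ (inside  ∷ C) (there i) = there (∈-expand⁺ C i)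
∈-expand⁺ (outside ∷ C) i         = there (∈-expand⁺ C i)

trace-expand : ∀ (C : Subset n) S → trace C (expand C S) ≡ S
trace-expand []            []      = refl
trace-expand (inside  ∷ C) (b ∷ S) = cong (b ∷_) (trace-expand C S)
trace-expand (outside ∷ C) S       = trace-expand C S

-- Neighbourhoods in a graph and in its induced subgraphs.

module _ (G : Graph n) where
  open Graph G using (_~_; _~?_)

  ∈N⁺ : ∀ {v u} → v ~ u → u ∈ N G v
  ∈N⁺ {v} {u} v~u =
    lookup⇒[]= u _ (trans (lookup∘tabulate _ u) (dec-true (v ~? u) v~u))

  ∈N⁻ : ∀ {v u} → u ∈ N G v → v ~ u
  ∈N⁻ {v} {u} u∈N with v ~? u | trans (sym (lookup∘tabulate _ u)) ([]=⇒lookup u∈N)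
  ... | yes v~u | _ = v~u

  ∈N[]-self : ∀ v → v ∈ N[ G ] v
  ∈N[]-self v = x∈p∪q⁺ (inj₂ (x∈⁅x⁆ v))

  ∈N[]⁺ : ∀ {v u} → v ~ u → u ∈ N[ G ] v
  ∈N[]⁺ = x∈p∪q⁺ ∘ inj₁ ∘ ∈N⁺

  ∈N[]⁻ : ∀ {v u} → u ∈ N[ G ] v → v ~ u ⊎ u ≡ v
  ∈N[]⁻ {v} u∈N with x∈p∪q⁻ (N G v) ⁅ v ⁆ u∈N
  ... | inj₁ u∈Nv = inj₁ (∈N⁻ u∈Nv)
  ... | inj₂ u∈⁅v⁆ = inj₂ (x∈⁅y⁆⇒x≡y v u∈⁅v⁆)

  N∩⊆N[]∩ : ∀ C v → N G v ∩ C ⊆ N[ G ] v ∩ C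
  N∩⊆N[]∩ C v x∈ with x∈p∩q⁻ (N G v) C x∈
  ... | x∈N , x∈C = x∈p∩q⁺ (x∈p∪q⁺ (inj₁ x∈N) , x∈C)

  -- Open and closed neighbourhoods differ only in `v` itself, which `C` omits. This links the open
  -- neighbourhoods in `IsGᴵ` with the closed ones in `Missing`.
  N[]∩≡N∩ : ∀ {C v} → v ∉ C → N[ G ] v ∩ C ≡ N G v ∩ C
  N[]∩≡N∩ {C} {v} v∉C = ⊆-antisym ⊆₁ (N∩⊆N[]∩ C v)
    where
    ⊆₁ : N[ G ] v ∩ C ⊆ N G v ∩ C
    ⊆₁ x∈ with x∈p∩q⁻ (N[ G ] v) C x∈
    ... | x∈N , x∈C with ∈N[]⁻ x∈N
    ... | inj₁ v~x  = x∈p∩q⁺ (∈N⁺ v~x , x∈C)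
    ... | inj₂ refl = contradiction x∈C v∉C

  total⇒dominating : ∀ {C} → TotalDominating G C → Dominating G C
  total⇒dominating {C} td v with td v
  ... | x , x∈ = x , N∩⊆N[]∩ C v x∈

module _ (G : Graph n) (C : Subset n) where

  ∈N[]-induced⁺ : ∀ {i j} → element C j ∈ N[ G ] (element C i) → j ∈ N[ G [ C ] ] i
  ∈N[]-induced⁺ {i} {j} e∈N with ∈N[]⁻ G e∈N
  ... | inj₁ i~j = ∈N[]⁺ (G [ C ]) i~j
  ... | inj₂ eq with element-injective C eq
  ... | refl = ∈N[]-self (G [ C ]) i

  ∈N[]-induced⁻ : ∀ {i j} → j ∈ N[ G [ C ] ] i → element C j ∈ N[ G ] (element C i)
  ∈N[]-induced⁻ {i} j∈N with ∈N[]⁻ (G [ C ]) j∈N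
  ... | inj₁ i~j  = ∈N[]⁺ G i~j
  ... | inj₂ refl = ∈N[]-self G (element C i)

  -- Turns the absence of closed twins in `G [ C ]` into a statement about traces on `C` of
  -- neighbourhoods in `G`.
  N[]-induced : ∀ i → N[ G [ C ] ] i ≡ trace C (N[ G ] (element C i))
  N[]-induced i = ⊆-antisym (∈-trace⁺ C ∘ ∈N[]-induced⁻) (∈N[]-induced⁺ ∘ ∈-trace⁻ C)

-- Equal closed neighbourhoods already force adjacency.
N[]-injective : ∀ (G : Graph n) → NoClosedTwins G → ∀ {u v} → u ≢ v → N[ G ] u ≢ N[ G ] v
N[]-injective G no-twin {u} {v} u≢v eq with ∈N[]⁻ G (subst (v ∈_) (sym eq) (∈N[]-self G v))
... | inj₁ u~v = no-twin u v (u≢v , u~v , eq)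
... | inj₂ v≡u = u≢v (sym v≡u)

-- The order of a graph with a given code.

-- The extra point `zero` takes the empty trace, which no vertex has when C is dominating.
closedTrace : (G : Graph n) (C : Subset n) → Fin (suc n) → Subset ∣ C ∣
closedTrace G C zero    = ⊥
closedTrace G C (suc v) = trace C (N[ G ] v)

closedTrace-injective : ∀ (G : Graph n) {C} → IsCode ID G C → Injective _≡_ _≡_ (closedTrace G C)
closedTrace-injective G {C} (sep , dom) {zero}  {zero}  _  = refl
closedTrace-injective G {C} (sep , dom) {zero}  {suc v} eq =
  contradiction (sym eq) (trace-nonempty C (dom v))
closedTrace-injective G {C} (sep , dom) {suc u} {zero}  eq =
  contradiction eq (trace-nonempty C (dom u))
closedTrace-injective G {C} (sep , dom) {suc u} {suc v} eq with u ≟ v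
... | yes refl = refl
... | no u≢v   = contradiction (trace≡⇒∩≡∩ C eq) (sep u v u≢v)

code⇒ID-code : ∀ X (G : Graph n) {C} → IsCode X G C → IsCode ID G C
code⇒ID-code ID  G code       = code
code⇒ID-code ITD G (sep , td) = sep , total⇒dominating G td

-- The strict inequality is `suc n ≤ 2 ^ ∣ C ∣`: the domain of `closedTrace` has one point more than
-- the graph.
code⇒order<2^ : ∀ X (G : Graph n) {C} → IsCode X G C → n < 2 ^ ∣ C ∣
code⇒order<2^ X G code = injective⇒≤2^ (closedTrace-injective G (code⇒ID-code X G code))

hasNumber⇒order<2^ : ∀ X (G : Graph n) {k} → HasNumber X G k → n < 2 ^ k
hasNumber⇒order<2^ X G (_ , (code , _) , refl) = code⇒order<2^ X G code

2^-cancel-≤ : ∀ {m n} → 2 ^ m ≤ 2 ^ n → m ≤ n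
2^-cancel-≤ 2^m≤2^n = ≮⇒≥ λ n<m → <⇒≱ (^-monoʳ-< 2 (s≤s (s≤s z≤n)) n<m) 2^m≤2^n

-- Comparison of densities.

number-unique : ∀ X (G : Graph n) {k l} → HasNumber X G k → HasNumber X G l → k ≡ l
number-unique X G (C , (codeC , minC) , refl) (D , (codeD , minD) , refl) =
  ≤-antisym (minC D codeD) (minD C codeC)

/-antimonoʳ-≤ : ∀ k {m n} .{{_ : NonZero m}} .{{_ : NonZero n}} →
  m ≤ n → (ℤ.+ k ℚ./ n) ℚ.≤ (ℤ.+ k ℚ./ m)
-- `ℚ._/_` reduces to lowest terms, so the fractions are compared unnormalised, where
-- cross-multiplication leaves `k * m ≤ k * n`.
/-antimonoʳ-≤ k {m@(suc _)} {n@(suc _)} m≤n = ℚ.toℚᵘ-cancel-≤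
  (ℚᵘ.≤-respʳ-≃ (ℚᵘ.≃-sym (ℚ.toℚᵘ-fromℚᵘ (ℤ.+ k ℚᵘ./ m)))
  (ℚᵘ.≤-respˡ-≃ (ℚᵘ.≃-sym (ℚ.toℚᵘ-fromℚᵘ (ℤ.+ k ℚᵘ./ n)))
  (ℚᵘ.*≤* (ℤ.*-monoˡ-≤-nonNeg (ℤ.+ k) (ℤ.+≤+ m≤n)))))

-- All competitors share the numerator `k`, so the density is least where the order is greatest.
largest⇒attainsMinimumDensity : ∀ X {k} (G : Graph n) .{{_ : NonZero n}} →
  HasNumber X G k → 2 ^ k ≤ suc n → AttainsMinimumDensity X k G
largest⇒attainsMinimumDensity {n = n@(suc _)} X {k} G num 2^k≤ =
  num , _ , record { γ = k ; hasNumber = num ; density = refl } , minimal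
  where
  minimal : ∀ {m} (H : Graph m) r → HasNumber X H k → HasDensity X H r → (ℤ.+ k ℚ./ n) ℚ.≤ r
  minimal H r numH record { hasNumber = numH′ ; density = refl }
    -- The density of `H` comes with its own `γ`, which must first be identified with `k`.
    with number-unique X H numH numH′
  -- From `suc m ≤ 2 ^ k ≤ suc n` follows `m ≤ n`.
  ... | refl = /-antimonoʳ-≤ k (s≤s⁻¹ (≤-trans (hasNumber⇒order<2^ X H numH) 2^k≤))

-- ITD-admissibility of twin-free graphs.

noIsolated⇔ITD-admissible : ∀ (G : Graph n) → NoClosedTwins G → NoIsolatedVertex G ⇔ Admissible ITD G
noIsolated⇔ITD-admissible G no-twin = mk⇔ to from
  where
  ∩⊤ : ∀ A → A ∩ ⊤ ≡ A
  ∩⊤ = ∩-identityʳ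
  to : NoIsolatedVertex G → Admissible ITD G
  -- The whole vertex set serves as the code, since traces on it are the neighbourhoods themselves.
  to noIso = ⊤ , separating , total
    where
    separating : ClosedSeparating G ⊤
    separating u v u≢v eq =
      N[]-injective G no-twin u≢v (trans (sym (∩⊤ (N[ G ] u))) (trans eq (∩⊤ (N[ G ] v))))
    total : TotalDominating G ⊤
    total v with nonempty? (N G v)
    ... | yes ne = subst Nonempty (sym (∩⊤ (N G v))) ne
    ... | no empty = contradiction empty (noIso v)
  from : Admissible ITD G → NoIsolatedVertex G
  from (D , _ , td) v empty with td v
  ... | x , x∈ = empty (x , p∩q⊆p (N G v) D x∈)

-- The graphs G^I(k).

module _ {k} (G : Graph n) (C : Subset n) (isG : IsGᴵ k G C) where
  open IsGᴵ isG

  separating : ClosedSeparating G C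
  separating u v u≢v eq with u ∈? C | v ∈? C
  -- The trace of an outside vertex is missing, hence not the trace of a vertex of `C`.
  ... | yes u∈C | no v∉C with only v v∉C
  ...   | _ , (_ , _ , no-u) , N∩≡C′ = no-u (u , u∈C , trans eq (trans (N[]∩≡N∩ G v∉C) N∩≡C′))
  separating u v u≢v eq | no u∉C | yes v∈C with only u u∉C
  ...   | _ , (_ , _ , no-v) , N∩≡C′ = no-v (v , v∈C , trans (sym eq) (trans (N[]∩≡N∩ G u∉C) N∩≡C′))
  -- Two outside vertices with the same missing trace coincide by uniqueness.
  separating u v u≢v eq | no u∉C | no v∉C with only u u∉C
  ...   | C′ , missing , N∩≡C′ with unique C′ missing
  ...   | _ , _ , uniq = u≢v (trans (sym (uniq (u∉C , N∩≡C′))) (uniq (v∉C ,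
            trans (sym (N[]∩≡N∩ G v∉C)) (trans (sym eq) (trans (N[]∩≡N∩ G u∉C) N∩≡C′)))))
  -- Equal traces of vertices of `C` would give closed twins in `G [ C ]`.
  separating u v u≢v eq | yes u∈C | yes v∈C
    with element-surjective C u∈C | element-surjective C v∈C
  ...   | i , refl | j , refl = N[]-injective (G [ C ]) no-twin (u≢v ∘ cong (element C)) (begin
    N[ G [ C ] ] i                     ≡⟨ N[]-induced G C i ⟩
    trace C (N[ G ] (element C i))     ≡⟨ trace-∩ C (N[ G ] (element C i)) ⟨
    trace C (N[ G ] (element C i) ∩ C) ≡⟨ cong (trace C) eq ⟩
    trace C (N[ G ] (element C j) ∩ C) ≡⟨ trace-∩ C (N[ G ] (element C j)) ⟩
    trace C (N[ G ] (element C j))     ≡⟨ N[]-induced G C j ⟨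
    N[ G [ C ] ] j                     ∎)
    where open ≡-Reasoning

  outside-nonempty : ∀ {v} → v ∉ C → Nonempty (N G v ∩ C)
  outside-nonempty v∉C with only _ v∉C
  ... | _ , (ne , _) , N∩≡C′ = subst Nonempty (sym N∩≡C′) ne

  isIDCode : IsCode ID G C
  isIDCode = separating , dominating
    where
    dominating : Dominating G C
    dominating v with v ∈? C
    ... | yes v∈C = v , x∈p∩q⁺ (∈N[]-self G v , v∈C)
    ... | no  v∉C = subst Nonempty (sym (N[]∩≡N∩ G v∉C)) (outside-nonempty v∉C)

  isITDCode : NoIsolatedVertex (G [ C ]) → IsCode ITD G C
  isITDCode noIso = separating , total
    where
    total : TotalDominating G C
    total v with v ∈? C
    ... | no  v∉C = outside-nonempty v∉C
    ... | yes v∈C with element-surjective C v∈C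
    ... | i , refl with nonempty? (N (G [ C ]) i)
    ... | yes (j , j∈N) = element C j , x∈p∩q⁺ (∈N⁺ G (∈N⁻ (G [ C ]) j∈N) , element-∈ C j)
    ... | no empty = contradiction empty (noIso i)

  -- Either a vertex of `C` has this trace, which a finite search decides, or `C′` is missing and
  -- `unique` supplies an outside vertex.
  subset-realised : ∀ C′ → Nonempty C′ → C′ ⊆ C → ∃[ v ] N[ G ] v ∩ C ≡ C′
  subset-realised C′ ne C′⊆C with any? (λ u → u ∈? C ×-dec ≡-dec _≟ᵇ_ (N[ G ] u ∩ C) C′)
  ... | yes (u , _ , eq) = u , eq
  ... | no none with unique C′ (ne , C′⊆C , none)
  ... | v , (v∉C , eq) , _ = v , trans (N[]∩≡N∩ G v∉C) eq

  closedTrace-surjective : StrictlySurjective _≡_ (closedTrace G C)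
  closedTrace-surjective S with nonempty? S
  -- The empty trace is the value at the extra point.
  ... | no empty = zero , sym (Empty-unique empty)
  ... | yes (i , i∈S) with subset-realised (expand C S) (element C i , ∈-expand⁺ C i∈S) (expand⊆ C S)
  ... | v , eq = suc v , trans (sym (trace-∩ C (N[ G ] v))) (trans (cong (trace C) eq) (trace-expand C S))

  2^k≤1+n : 2 ^ k ≤ suc n
  2^k≤1+n = subst (λ c → 2 ^ c ≤ suc n) size (surjective⇒2^≤ closedTrace-surjective)

  -- For any code `D`, `2 ^ k ≤ suc n ≤ 2 ^ ∣ D ∣`, whence `k ≤ ∣ D ∣`.
  code⇒minimum : ∀ X → IsCode X G C → IsMinimumCode X G C
  code⇒minimum X code = code , λ D codeD → subst (_≤ ∣ D ∣) (sym size)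
    (2^-cancel-≤ (≤-trans 2^k≤1+n (code⇒order<2^ X G codeD)))

  code⇒attainsMinimumDensity : ∀ X → .{{_ : NonZero n}} → IsCode X G C → AttainsMinimumDensity X k G
  code⇒attainsMinimumDensity X code =
    largest⇒attainsMinimumDensity X G (C , code⇒minimum X code , size) 2^k≤1+n

theorem6 : ∀ {n} (k : ℕ) → 3 ≤ k → (G : Graph n) (C : Subset n) → IsGᴵ k G C →
    IsMinimumCode ID G C ×
    (NoIsolatedVertex (G [ C ]) ⇔ Admissible ITD (G [ C ])) ×
    (NoIsolatedVertex (G [ C ]) → IsMinimumCode ITD G C) ×
    AttainsMinimumDensity ID k G ×
    (NoIsolatedVertex (G [ C ]) → AttainsMinimumDensity ITD k G)
theorem6 {n} k 3≤k G C isG =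
  code⇒minimum G C isG ID idCode ,
  noIsolated⇔ITD-admissible (G [ C ]) no-twin ,
  code⇒minimum G C isG ITD ∘ itdCode ,
  code⇒attainsMinimumDensity G C isG ID idCode ,
  code⇒attainsMinimumDensity G C isG ITD ∘ itdCode
  where
  open IsGᴵ isG
  idCode : IsCode ID G C
  idCode = isIDCode G C isG
  itdCode : NoIsolatedVertex (G [ C ]) → IsCode ITD G C
  itdCode = isITDCode G C isG
  instance
    n≢0 : NonZero n
    -- A density needs a vertex: `1 ≤ 3 ≤ k = ∣ C ∣ ≤ n`.
    n≢0 = >-nonZero (≤-trans (≤-trans (s≤s z≤n) 3≤k) (subst (_≤ n) size (∣p∣≤n C)))
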